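{- For every integer $k>2$, the matroid $M_k$ satisfies $\chi_g(M_k)\ge 2k-1$.
   Context: For $k>2$, let $E_k=C\cup D_1\cup\dots\cup D_{3k(2k-1)}$, where $C,D_1,\dots,D_{3k(2k-1)}$ are pairwise disjoint, $|C|=k(2k-1)$ and $|D_i|=k$ for each $i$. $M_k$ is the transversal matroid on $E_k$ of the family of sets consisting of $D_1,\dots,D_{3k(2k-1)}$ together with $2k-1$ copies of $E_k$; i.e. a subset $X\subseteq E_k$ is independent iff its elements can be matched injectively to distinct members of this family (indexed with multiplicity) with each element lying in the member it is matched to. For a loopless matroid $M$, $\chi_g(M)$ is the minimum number of colors for which Alice has a winning strategy in the following game: Alice and Bob alternately (Alice first) color an uncolored element with one of the colors so that at every moment every color class is independent in $M$; Alice wins if the whole ground set is colored, Bob wins if a partial coloring is reached that cannot be extended. -}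

module Defs where

open import Data.Nat using (ℕ; _*_; _∸_)
open import Data.Fin using (Fin)
open import Data.Sum using (_⊎_; inj₁; inj₂)
open import Data.Product using (_×_; _,_; Σ; ∃; ∃-syntax)
open import Data.Maybe using (Maybe; just; nothing)
open import Data.Unit using (⊤)
open import Data.Empty using (⊥)
open import Relation.Binary.PropositionalEquality using (_≡_; _≢_)

sizeC : ℕ → ℕ
sizeC k = k * (2 * k ∸ 1)

numD : ℕ → ℕ
numD k = 3 * sizeC k

-- Ground set E_k = C ⊎ D_1 ⊎ ... ⊎ D_{3k(2k-1)}, with D_i = {i} × Fin k.
E : ℕ → Set
E k = Fin (sizeC k) ⊎ (Fin (numD k) × Fin k)

-- Index set of the family (with multiplicity):
--   inj₁ i : the set D_i ;  inj₂ j : the j-th copy of E_k  (2k-1 copies)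
Idx : ℕ → Set
Idx k = Fin (numD k) ⊎ Fin (2 * k ∸ 1)

_∈A_ : {k : ℕ} → E k → Idx k → Set
_∈A_ (inj₁ c)       (inj₁ i) = ⊥
_∈A_ (inj₂ (i , _)) (inj₁ j) = i ≡ j
_∈A_ x              (inj₂ _) = ⊤

-- Independence in the transversal matroid M_k: the elements of X can be
-- matched injectively to members of the family containing them.
Independent : (k : ℕ) → (E k → Set) → Set
Independent k X =
  Σ (E k → Idx k) λ f → ((∀ x → X x → _∈A_ {k} x (f x)) ×
          (∀ x y → X x → X y → f x ≡ f y → x ≡ y))

Coloring : ℕ → ℕ → Set
Coloring k c = E k → Maybe (Fin c)

Proper : {k c : ℕ} → Coloring k c → Set
Proper {k} {c} p = (a : Fin c) → Independent k (λ x → p x ≡ just a)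

Full : {k c : ℕ} → Coloring k c → Set
Full {k} p = (x : E k) → ∃[ a ] (p x ≡ just a)

Move : {k c : ℕ} → Coloring k c → E k → Fin c → Coloring k c → Set
Move {k} p e a p' =
  (p e ≡ nothing) × (p' e ≡ just a) ×
  (∀ x → x ≢ e → p' x ≡ p x) × Proper p'

-- Alice wins from position p (Alice to move / Bob to move).
-- The game ends either when everything is colored (Alice wins) or when
-- an uncolored element remains but no legal move exists (Bob wins).
mutual
  data AliceWinsA {k c : ℕ} (p : Coloring k c) : Set where
    doneA : Full p → AliceWinsA p
    moveA : (e : E k) (a : Fin c) (p' : Coloring k c) →
            Move p e a p' → AliceWinsB p' → AliceWinsA p

  data AliceWinsB {k c : ℕ} (p : Coloring k c) : Set where
    doneB : Full p → AliceWinsB p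
    allB  : (∃[ e ] ∃[ a ] ∃[ p' ] Move p e a p') →
            ((e : E k) (a : Fin c) (p' : Coloring k c) →
              Move p e a p' → AliceWinsA p') →
            AliceWinsB p

empty : {k c : ℕ} → Coloring k c
empty _ = nothing

AliceWins : (k c : ℕ) → Set
AliceWins k c = AliceWinsA {k} {c} empty

{-# OPTIONS --safe #-}
module Submission where

-- Write N = 2k-1.  A set X is independent iff its load |X ∩ C| + Σᵢ (|X ∩ Dᵢ| ∸ 1)
-- is at most N; the slack of a colour is N minus the load of its class.  Every
-- element of C that is coloured uses one unit of slack, so Alice has lost once
-- the total slack is less than the number of uncoloured elements of C.  Bob
-- wastes slack: he colours a whole Dᵢ with one colour, which costs k-1 units of
-- slack in k moves, whereas an Alice move in C lowers both quantities by one
-- and an Alice move outside C only costs her time.  With at most N-1 colours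
-- the total slack exceeds |C| = kN by at most (k-2)N initially, while Bob can
-- waste (k-1)N units during kN rounds.  Alice can cut a run of Bob short by
-- exhausting its colour, which is paid for by counting every colour with slack
-- one unit extra, or by colouring an element of the same Dᵢ, which is paid for
-- by the move that she spends outside C.

open import Defs
open import Data.Bool using (if_then_else_)
open import Data.Empty using (⊥; ⊥-elim)
open import Data.Fin using (Fin; zero; suc; toℕ; punchIn)
import Data.Fin.Properties as Finₚ
open import Data.List using ([]; _∷_)
open import Data.Maybe using (Maybe; just; nothing)
import Data.Maybe.Properties as Maybeₚ
open import Data.Nat using (ℕ; zero; suc; _+_; _*_; _∸_; _<_; _≤_; z≤n; s≤s; s≤s⁻¹; NonZero; >-nonZero)
open import Data.Nat.DivMod using (_%_; _mod_; m%n<n; m<n⇒m%n≡m)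
open import Data.Nat.Properties
open import Data.Nat.Tactic.RingSolver using (solve; solve-∀)
open import Data.Product using (_×_; _,_; proj₁; proj₂; ∃-syntax)
import Data.Product.Properties as Productₚ
open import Data.Sum using (_⊎_; inj₁; inj₂)
import Data.Sum.Properties as Sumₚ
open import Function using (_∘_; _$_; case_of_)
open import Relation.Binary.PropositionalEquality
open import Relation.Nullary using (Dec; yes; no; does; ¬_; contradiction; _×-dec_)
open import Relation.Nullary.Decidable using (dec-true; dec-false)

open import Algebra.Properties.CommutativeMonoid.Sum +-0-commutativeMonoid
  using (sum; sum-remove; sum-cong-≗; ∑-comm; ∑-distrib-+)

private variable
  n : ℕ

-- Indicators and finite sums

𝟙 : {P : Set} → Dec P → ℕ
𝟙 (yes _) = 1
𝟙 (no _)  = 0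

𝟙≤1 : {P : Set} (d : Dec P) → 𝟙 d ≤ 1
𝟙≤1 (yes _) = ≤-refl
𝟙≤1 (no _)  = z≤n

0<𝟙⇒ : {P : Set} {d : Dec P} → 0 < 𝟙 d → P
0<𝟙⇒ {d = yes p} _ = p

⇒0<𝟙 : {P : Set} (d : Dec P) → P → 0 < 𝟙 d
⇒0<𝟙 (yes _) _ = ≤-refl
⇒0<𝟙 (no ¬p) p = contradiction p ¬p

m≤1⇒m≤n : {m n : ℕ} → m ≤ 1 → (0 < m → 0 < n) → m ≤ n
m≤1⇒m≤n {zero}  _   _ = z≤n
m≤1⇒m≤n {suc m} m≤1 f = ≤-trans m≤1 (f (s≤s z≤n))

𝟙-mono : {P Q : Set} (d : Dec P) (e : Dec Q) → (P → Q) → 𝟙 d ≤ 𝟙 e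
𝟙-mono d e f = m≤1⇒m≤n (𝟙≤1 d) (⇒0<𝟙 e ∘ f ∘ 0<𝟙⇒)

¬⇒𝟙≡0 : {P : Set} (d : Dec P) → ¬ P → 𝟙 d ≡ 0
¬⇒𝟙≡0 (yes p) ¬p = contradiction p ¬p
¬⇒𝟙≡0 (no _)  _  = refl

sum-mono : {f g : Fin n → ℕ} → (∀ i → f i ≤ g i) → sum f ≤ sum g
sum-mono {zero}  f≤g = z≤n
sum-mono {suc n} f≤g = +-mono-≤ (f≤g zero) (sum-mono (f≤g ∘ suc))

-- Split off the term at `i`. The margins `s` and `t` make one lemma serve for a drop (`s` positive)
-- and for a rise of at most one (`t = 1`), without subtraction.
sum-mono-except : {f g : Fin n → ℕ} (i : Fin n) (s t : ℕ) →
  (∀ j → j ≢ i → f j ≤ g j) → f i + s ≤ g i + t → sum f + s ≤ sum g + t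
sum-mono-except {suc n} {f} {g} i s t f≤g fi≤gi = begin
  sum f + s               ≡⟨ cong (_+ s) (sum-remove {i = i} f) ⟩
  (f i + rest f) + s      ≡⟨ swap (f i) (rest f) s ⟩
  (f i + s) + rest f      ≤⟨ +-mono-≤ fi≤gi (sum-mono λ j → f≤g _ (Finₚ.punchInᵢ≢i i j)) ⟩
  (g i + t) + rest g      ≡⟨ swap (g i) (rest g) t ⟨
  (g i + rest g) + t      ≡⟨ cong (_+ t) (sum-remove {i = i} g) ⟨
  sum g + t               ∎
  where
  open ≤-Reasoning
  rest : (Fin (suc n) → ℕ) → ℕ
  rest h = sum (h ∘ punchIn i)
  swap : ∀ x y z → (x + y) + z ≡ (x + z) + y
  swap = solve-∀

term≤sum : (f : Fin n → ℕ) (i : Fin n) → f i ≤ sum f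
term≤sum {suc n} f zero    = m≤m+n (f zero) _
term≤sum {suc n} f (suc i) = ≤-trans (term≤sum (f ∘ suc) i) (m≤n+m _ (f zero))

sum-const : (n m : ℕ) → sum {n} (λ _ → m) ≡ n * m
sum-const zero    m = refl
sum-const (suc n) m = cong (m +_) (sum-const n m)

0<sum⇒ : (f : Fin n → ℕ) → 0 < sum f → ∃[ i ] 0 < f i
0<sum⇒ {suc n} f 0<s with f zero in eq
... | suc _ = zero , subst (0 <_) (sym eq) (s≤s z≤n)
... | zero with 0<sum⇒ (f ∘ suc) 0<s
...   | i , 0<fi = suc i , 0<fi

sum≤1 : {f : Fin n → ℕ} → (∀ i → f i ≤ 1) →
  (∀ i j → 0 < f i → 0 < f j → i ≡ j) → sum f ≤ 1
sum≤1 {zero} _ _ = z≤n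
sum≤1 {suc n} {f} f≤1 uniq with f zero in eq₀ | sum (f ∘ suc) in eq
... | zero  | _     = subst (_≤ 1) eq (sum≤1 (f≤1 ∘ suc) λ i j p q → Finₚ.suc-injective (uniq _ _ p q))
... | suc m | zero  = subst (_≤ 1) (trans eq₀ (sym (+-identityʳ _))) (f≤1 zero)
... | suc m | suc _ with 0<sum⇒ (f ∘ suc) (subst (0 <_) (sym eq) (s≤s z≤n))
...   | i , 0<fi with () ← uniq zero (suc i) (subst (0 <_) (sym eq₀) (s≤s z≤n)) 0<fi

+≤1 : {a b : ℕ} → a ≤ 1 → b ≤ 1 → (0 < a → 0 < b → ⊥) → a + b ≤ 1
+≤1 {zero}  _   b≤1 _ = b≤1
+≤1 {suc a} {zero}  a≤1 _ _ = subst (_≤ 1) (sym (+-identityʳ (suc a))) a≤1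
+≤1 {suc a} {suc b} _ _ disj = ⊥-elim (disj (s≤s z≤n) (s≤s z≤n))

-- The map (i , t) ↦ offset w i + t enumerates the pairs with t < w i.
offset : (Fin n → ℕ) → Fin n → ℕ
offset w zero    = 0
offset w (suc i) = w zero + offset (w ∘ suc) i

offset< : (w : Fin n → ℕ) {i : Fin n} {t : ℕ} → t < w i → offset w i + t < sum w
offset< w {zero}  t<w = ≤-trans t<w (term≤sum w zero)
offset< w {suc i} t<w =
  subst (_< sum w) (sym (+-assoc (w zero) _ _)) (+-monoʳ-< (w zero) (offset< (w ∘ suc) t<w))

offset-injective : (w : Fin n → ℕ) {i j : Fin n} {t u : ℕ} → t < w i → u < w j →
  offset w i + t ≡ offset w j + u → i ≡ j × t ≡ u
offset-injective w {zero}  {zero}  p q eq = refl , eq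
offset-injective w {zero}  {suc j} {t} p q eq = ⊥-elim $ <-irrefl eq $
  <-≤-trans p (≤-trans (m≤m+n (w zero) _) (≤-reflexive (sym (+-assoc (w zero) _ _))))
offset-injective w {suc i} {zero}  p q eq = ⊥-elim $ <-irrefl (sym eq) $
  <-≤-trans q (≤-trans (m≤m+n (w zero) _) (≤-reflexive (sym (+-assoc (w zero) _ _))))
offset-injective w {suc i} {suc j} p q eq
  with refl , t≡u ← offset-injective (w ∘ suc) p q
         (+-cancelˡ-≡ (w zero) _ _
           (trans (sym (+-assoc (w zero) _ _)) (trans eq (+-assoc (w zero) _ _)))) = refl , t≡u

-- Below `N` reduction is the identity; `mod` only turns a rank into the index of a copy of `E k` by
-- a total function, with no bound demanded in the definition.
mod-injective : {N a b : ℕ} .{{_ : NonZero N}} → a < N → b < N → a mod N ≡ b mod N → a ≡ b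
mod-injective {N} {a} {b} a<N b<N eq = begin
  a              ≡⟨ m<n⇒m%n≡m a<N ⟨
  a % N          ≡⟨ Finₚ.toℕ-fromℕ< (m%n<n a N) ⟨
  toℕ (a mod N)  ≡⟨ cong toℕ eq ⟩
  toℕ (b mod N)  ≡⟨ Finₚ.toℕ-fromℕ< (m%n<n b N) ⟩
  b % N          ≡⟨ m<n⇒m%n≡m b<N ⟩
  b              ∎
  where open ≡-Reasoning

⇒𝟙≡1 : {P : Set} (d : Dec P) → P → 𝟙 d ≡ 1
⇒𝟙≡1 d p = ≤-antisym (𝟙≤1 d) (⇒0<𝟙 d p)

-- The extra unit of an open colour pays for the run that Bob loses when the
-- colour is filled up.
weight : ℕ → ℕ
weight zero    = 0
weight (suc s) = 2 + s

s≤weight : ∀ s → s ≤ weight s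
s≤weight zero    = z≤n
s≤weight (suc s) = n≤1+n (suc s)

weight-strict : ∀ {s t} → s < t → weight s < weight t
weight-strict {zero}  {suc t} _ = s≤s z≤n
weight-strict {suc s} {suc t} (s≤s s<t) = s≤s (s≤s s<t)

weight-mono : ∀ {s t} → s ≤ t → weight s ≤ weight t
weight-mono {zero}          _         = z≤n
weight-mono {suc s} {suc t} (s≤s s≤t) = s≤s (s≤s s≤t)

2≤weight : ∀ {s} → 0 < s → 2 ≤ weight s
2≤weight {suc s} _ = s≤s (s≤s z≤n)

weight≤suc : ∀ s → weight s ≤ suc s
weight≤suc zero    = z≤n
weight≤suc (suc s) = ≤-refl

-- Alice can end a run by colouring an element of its D_i.  With at most one
-- element left in the run, Bob then has to start over from an untouched set,
-- and Alice may have touched one more; "reserve" covers this.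
reserve : ℕ → ℕ
reserve 0             = 2
reserve 1             = 2
reserve (suc (suc _)) = 0

reserve≤2 : ∀ f → reserve f ≤ 2
reserve≤2 0             = ≤-refl
reserve≤2 1             = ≤-refl
reserve≤2 (suc (suc _)) = z≤n

reserve≡0 : ∀ {f} → 2 ≤ f → reserve f ≡ 0
reserve≡0 {suc (suc _)} _ = refl
reserve≡0 {suc zero} (s≤s ())

-- Arithmetic of the invariants

0<1∸n⇒n≡0 : ∀ {n} → 0 < 1 ∸ n → n ≡ 0
0<1∸n⇒n≡0 {zero}  _ = refl
0<1∸n⇒n≡0 {suc n} h = contradiction (subst (0 <_) (0∸n≡0 n) h) λ ()

0<2*⇒ : ∀ {n} → 0 < 2 * n → 0 < n
0<2*⇒ {suc n} _ = s≤s z≤n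

3≤2*⇒ : ∀ {n} → 3 ≤ 2 * (n + 1) → 0 < n
3≤2*⇒ {zero}  (s≤s (s≤s ()))
3≤2*⇒ {suc n} _ = s≤s z≤n

-- Linear arithmetic: `a ≤ b` is a weighted sum of hypotheses and `t` collects what cancels, so that
-- only ring identities remain.
by-sum : ∀ {a b x y} → a ≤ b → ∀ t → x + t ≡ a → b ≡ y + t → x ≤ y
by-sum {x = x} {y} a≤b t refl refl = +-cancelʳ-≤ t x y a≤b

infixl 6 _⊞_
_⊞_ : ∀ {a b x y} → a ≤ b → x ≤ y → a + x ≤ b + y
_⊞_ = +-mono-≤

scale : ∀ n {a b} → a ≤ b → n * a ≤ n * b
scale n = *-monoʳ-≤ n

module _ {σ σ′ r r′ m : ℕ} where

  -- Throughout, `σ` is the weighted slack, `r` the number of uncoloured elements of `C`, `m` the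
  -- number of runs still granted, and primes mark the position after a move. A move in `C` and a
  -- wasting move together lower `σ` by at least two and `2 * r` by two; `m` pays for Bob's opening
  -- moves, which waste nothing.
  budget-C : σ′ + 1 ≤ σ → r ≤ r′ + 1 → σ + 1 + m ≤ 2 * r → σ′ + m ≤ 2 * r′
  budget-C σ≤ r≤ h = by-sum (σ≤ ⊞ scale 2 r≤ ⊞ h) (2 + σ + 2 * r)
    (solve (σ ∷ σ′ ∷ r ∷ m ∷ [])) (solve (σ ∷ r ∷ r′ ∷ []))

  -- The second unit that `σ` loses when a colour is filled grants one more run.
  budget-C-full : σ′ + 2 ≤ σ → r ≤ r′ + 1 → σ + 1 + m ≤ 2 * r → σ′ + (1 + m) ≤ 2 * r′
  budget-C-full σ≤ r≤ h = by-sum (σ≤ ⊞ scale 2 r≤ ⊞ h) (2 + σ + 2 * r)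
    (solve (σ ∷ σ′ ∷ r ∷ m ∷ [])) (solve (σ ∷ r ∷ r′ ∷ []))

  -- The unit set aside for Alice's move is left over, since `r` did not go down; it grants one more
  -- run.
  budget-D : σ′ ≤ σ → r ≤ r′ → σ + 1 + m ≤ 2 * r → σ′ + (1 + m) ≤ 2 * r′
  budget-D σ≤ r≤ h = by-sum (σ≤ ⊞ scale 2 r≤ ⊞ h) (σ + 2 * r)
    (solve (σ ∷ σ′ ∷ r ∷ m ∷ [])) (solve (σ ∷ r ∷ r′ ∷ []))

  budget-continue : σ′ + 1 ≤ σ → r ≤ r′ → σ + m ≤ 2 * r → σ′ + 1 + m ≤ 2 * r′
  budget-continue σ≤ r≤ h = ≤-trans (+-monoˡ-≤ m σ≤) (≤-trans h (scale 2 r≤))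

  budget-full : σ′ + 2 ≤ σ → r ≤ r′ → σ + m ≤ 2 * r → σ′ + 1 + (1 + m) ≤ 2 * r′
  budget-full σ≤ r≤ h = by-sum (σ≤ ⊞ scale 2 r≤ ⊞ h) (σ + 2 * r)
    (solve (σ ∷ σ′ ∷ r ∷ m ∷ [])) (solve (σ ∷ r ∷ r′ ∷ []))

  budget-start : σ′ ≤ σ → r ≤ r′ → σ + (1 + m) ≤ 2 * r → σ′ + 1 + m ≤ 2 * r′
  budget-start σ≤ r≤ h = by-sum (σ≤ ⊞ scale 2 r≤ ⊞ h) (σ + 2 * r)
    (solve (σ ∷ σ′ ∷ r ∷ m ∷ [])) (solve (σ ∷ r ∷ r′ ∷ []))

module _ {k r r′ f m : ℕ} where

  -- An abandoned run has fewer than `k` moves left, so one full run replaces it.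
  cover-restart : r′ ≤ r → 1 + f ≤ k → r ≤ 1 + f + k * m → r′ ≤ k * (1 + m)
  cover-restart r≤ f≤ h = by-sum (r≤ ⊞ f≤ ⊞ h) (r + 1 + f)
    (solve (r ∷ r′ ∷ f ∷ k ∷ m ∷ [])) (solve (r ∷ f ∷ k ∷ m ∷ []))

  -- Two units are lost, one written off from the run and one because `r` did not go down; an extra
  -- run of `k` moves outweighs them.
  cover-D : r′ ≤ r → 2 ≤ k → r ≤ 1 + (2 + f) + k * m → r′ ≤ 1 + f + k * (1 + m)
  cover-D r≤ f≤ h = by-sum (r≤ ⊞ f≤ ⊞ h) (r + 2)
    (solve (r ∷ r′ ∷ f ∷ k ∷ m ∷ [])) (solve (r ∷ f ∷ k ∷ m ∷ []))

  cover-full : r′ ≤ r → f ≤ k → r ≤ 1 + f + k * m → r′ ≤ 1 + 0 + k * (1 + m)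
  cover-full r≤ f≤ h = by-sum (r≤ ⊞ f≤ ⊞ h) (r + f)
    (solve (r ∷ r′ ∷ f ∷ k ∷ m ∷ [])) (solve (r ∷ f ∷ k ∷ m ∷ []))

module _ {σ σ′ r r′ d d′ : ℕ} where

  -- `d` counts the untouched sets. The supply lets Bob run out of them at the start of a run only
  -- if `σ < r`, when Alice has already lost.
  supply-C : ∀ {x} → σ′ + 1 ≤ σ → r ≤ r′ + 1 → d ≤ d′ → 3 * σ + x ≤ d + 3 * r → 3 * σ′ + x ≤ d′ + 3 * r′
  supply-C {x} σ≤ r≤ d≤ h = by-sum (scale 3 σ≤ ⊞ scale 3 r≤ ⊞ d≤ ⊞ h) (3 + 3 * σ + 3 * r + d)
    (solve (σ ∷ σ′ ∷ r ∷ d ∷ x ∷ [])) (solve (σ ∷ r ∷ r′ ∷ d ∷ d′ ∷ []))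

  supply-C-full : ∀ {x} → σ′ + 2 ≤ σ → r ≤ r′ + 1 → d ≤ d′ → 3 * σ + x ≤ d + 3 * r → 3 * σ′ + 1 ≤ d′ + 3 * r′
  supply-C-full {x} σ≤ r≤ d≤ h = by-sum (scale 3 σ≤ ⊞ scale 3 r≤ ⊞ d≤ ⊞ ≤-trans (m≤m+n (3 * σ) x) h ⊞ z≤n {2})
    (5 + 3 * σ + 3 * r + d)
    (solve (σ ∷ σ′ ∷ r ∷ d ∷ [])) (solve (σ ∷ r ∷ r′ ∷ d ∷ d′ ∷ []))

  supply-D : σ′ ≤ σ → r ≤ r′ → d ≤ d′ + 1 → 3 * σ + 2 ≤ d + 3 * r → 3 * σ′ + 1 ≤ d′ + 3 * r′
  supply-D σ≤ r≤ d≤ h = by-sum (scale 3 σ≤ ⊞ scale 3 r≤ ⊞ d≤ ⊞ h) (1 + 3 * σ + 3 * r + d)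
    (solve (σ ∷ σ′ ∷ r ∷ d ∷ [])) (solve (σ ∷ r ∷ r′ ∷ d ∷ d′ ∷ []))

  supply-D-continue : σ′ ≤ σ → r ≤ r′ → d ≤ d′ + 1 → 3 * σ + 0 ≤ d + 3 * r → 3 * σ′ ≤ d′ + 1 + 3 * r′
  supply-D-continue σ≤ r≤ d≤ h = by-sum (scale 3 σ≤ ⊞ scale 3 r≤ ⊞ d≤ ⊞ h) (3 * σ + 3 * r + d)
    (solve (σ ∷ σ′ ∷ r ∷ d ∷ [])) (solve (σ ∷ r ∷ r′ ∷ d ∷ d′ ∷ []))

  supply-D-full : σ′ + 2 ≤ σ → r ≤ r′ → d ≤ d′ + 1 → 3 * σ + 0 ≤ d + 3 * r → 3 * σ′ + 1 ≤ d′ + 3 * r′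
  supply-D-full σ≤ r≤ d≤ h = by-sum (scale 3 σ≤ ⊞ scale 3 r≤ ⊞ d≤ ⊞ h ⊞ z≤n {4}) (5 + 3 * σ + 3 * r + d)
    (solve (σ ∷ σ′ ∷ r ∷ d ∷ [])) (solve (σ ∷ r ∷ r′ ∷ d ∷ d′ ∷ []))

  -- Origin of the coefficient 3: a wasted unit of slack repays one set that Alice may have touched
  -- and refills a reserve of up to two.
  supply-continue : ∀ {x} → x ≤ 2 → σ′ + 1 ≤ σ → r ≤ r′ → d ≤ d′ →
    3 * σ ≤ d + 1 + 3 * r → 3 * σ′ + x ≤ d′ + 3 * r′
  supply-continue {x} x≤2 σ≤ r≤ d≤ h = by-sum (x≤2 ⊞ scale 3 σ≤ ⊞ scale 3 r≤ ⊞ d≤ ⊞ h)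
    (3 + 3 * σ + 3 * r + d)
    (solve (σ ∷ σ′ ∷ r ∷ d ∷ x ∷ [])) (solve (σ ∷ r ∷ r′ ∷ d ∷ d′ ∷ []))

  supply-start : σ′ ≤ σ → r ≤ r′ → d ≤ d′ + 1 → 3 * σ + 1 ≤ d + 3 * r → 3 * σ′ + 0 ≤ d′ + 3 * r′
  supply-start σ≤ r≤ d≤ h = by-sum (scale 3 σ≤ ⊞ scale 3 r≤ ⊞ d≤ ⊞ h) (1 + 3 * σ + 3 * r + d)
    (solve (σ ∷ σ′ ∷ r ∷ d ∷ [])) (solve (σ ∷ r ∷ r′ ∷ d ∷ d′ ∷ []))

module _ {c n k σ : ℕ} (c<n : c < n) (n≡ : 1 + n ≡ 2 * k) (σ≤ : σ ≤ c * (1 + n)) where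

  open ≤-Reasoning

  -- Each colour weighs at most `1 + n`. The weight of one further colour pays for the `n` runs and
  -- the unit set aside, and `n` such weights make `2 * (k * n)`.
  budget-initial : σ + 1 + n ≤ 2 * (k * n)
  budget-initial = begin
    σ + 1 + n              ≤⟨ +-monoˡ-≤ n (+-monoˡ-≤ 1 σ≤) ⟩
    c * (1 + n) + 1 + n    ≡⟨ solve (c ∷ n ∷ []) ⟩
    (1 + c) * (1 + n)      ≤⟨ *-monoˡ-≤ (1 + n) c<n ⟩
    n * (1 + n)            ≡⟨ cong (n *_) n≡ ⟩
    n * (2 * k)            ≡⟨ solve (k ∷ n ∷ []) ⟩
    2 * (k * n)            ∎

  supply-initial : 3 * σ + 2 ≤ 3 * (k * n) + 3 * (k * n)
  supply-initial = begin
    3 * σ + 2                              ≤⟨ m≤m+n _ (1 + 3 * n) ⟩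
    3 * σ + 2 + (1 + 3 * n)                ≡⟨ solve (σ ∷ n ∷ []) ⟩
    3 * (σ + 1 + n)                        ≤⟨ scale 3 budget-initial ⟩
    3 * (2 * (k * n))                      ≡⟨ solve (k ∷ n ∷ []) ⟩
    3 * (k * n) + 3 * (k * n)              ∎

inj₁≢inj₂ : {A B : Set} {x : A} {y : B} → inj₁ x ≢ inj₂ y
inj₁≢inj₂ ()

D-index-injective : {A I J : Set} {i : I} {j j′ : J} →
  _≡_ {A = A ⊎ (I × J)} (inj₂ (i , j)) (inj₂ (i , j′)) → j ≡ j′
D-index-injective refl = refl

module _ {k c : ℕ} where

  -- Independence as a bound on the load

  copies : ℕ
  copies = 2 * k ∸ 1

  _≟ᵉ_ : (x y : E k) → Dec (x ≡ y)
  _≟ᵉ_ = Sumₚ.≡-dec Finₚ._≟_ (Productₚ.≡-dec Finₚ._≟_ Finₚ._≟_)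

  _≟ⁱ_ : (x y : Idx k) → Dec (x ≡ y)
  _≟ⁱ_ = Sumₚ.≡-dec Finₚ._≟_ Finₚ._≟_

  _≟ᵐ_ : (x y : Maybe (Fin c)) → Dec (x ≡ y)
  _≟ᵐ_ = Maybeₚ.≡-dec Finₚ._≟_

  has : Coloring k c → Maybe (Fin c) → E k → ℕ
  has p v x = 𝟙 (p x ≟ᵐ v)

  countC : Coloring k c → Maybe (Fin c) → ℕ
  countC p v = sum λ x → has p v (inj₁ x)

  countD : Coloring k c → Maybe (Fin c) → Fin (numD k) → ℕ
  countD p v i = sum λ j → has p v (inj₂ (i , j))

  excess : Coloring k c → Fin c → Fin (numD k) → ℕ
  excess p a i = countD p (just a) i ∸ 1

  load : Coloring k c → Fin c → ℕ
  load p a = countC p (just a) + sum (excess p a)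

  module _ {p : Coloring k c} {a : Fin c} where

    -- Double counting of the matched pairs that involve a copy of `E k`: each element of `C` needs
    -- a copy, each `D_i` spares at most one of its elements, and each copy serves at most one
    -- element.
    independent⇒load≤ : Independent k (λ x → p x ≡ just a) → load p a ≤ copies
    independent⇒load≤ (f , f∈ , f-inj) = begin
      countC p (just a) + sum (excess p a)
        ≤⟨ +-mono-≤ (sum-mono C≤) (sum-mono D≤) ⟩
      sum (λ x → sum (use (inj₁ x))) + sum (λ i → sum λ j → sum (use (inj₂ (i , j))))
        ≡⟨ cong₂ _+_ (∑-comm λ x → use (inj₁ x))
             (trans (sum-cong-≗ λ i → ∑-comm λ j → use (inj₂ (i , j)))
                    (∑-comm λ i l → sum λ j → use (inj₂ (i , j)) l)) ⟩
      sum useC + sum useD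
        ≡⟨ ∑-distrib-+ useC useD ⟨
      sum (λ l → useC l + useD l)
        ≤⟨ sum-mono total≤1 ⟩
      sum {copies} (λ _ → 1)
        ≡⟨ trans (sum-const copies 1) (*-identityʳ copies) ⟩
      copies ∎
      where
      open ≤-Reasoning

      -- `f` is constrained only on the class, so membership is part of the indicator.
      via? : (x : E k) (y : Idx k) → Dec (p x ≡ just a × f x ≡ y)
      via? x y = (p x ≟ᵐ just a) ×-dec (f x ≟ⁱ y)

      use : E k → Fin copies → ℕ
      use x l = 𝟙 (via? x (inj₂ l))

      useC useD : Fin copies → ℕ
      useC l = sum λ x → use (inj₁ x) l
      useD l = sum λ i → sum λ j → use (inj₂ (i , j)) l

      via-unique : ∀ {x x′ y} → 0 < 𝟙 (via? x y) → 0 < 𝟙 (via? x′ y) → x ≡ x′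
      via-unique u u′ with px , fx ← 0<𝟙⇒ u | px′ , fx′ ← 0<𝟙⇒ u′ =
        f-inj _ _ px px′ (trans fx (sym fx′))

      uses : ∀ {x} l → p x ≡ just a → f x ≡ inj₂ l → 0 < sum (use x)
      uses {x} l px fx = ≤-trans (⇒0<𝟙 (via? x (inj₂ l)) (px , fx)) (term≤sum (use x) l)

      C-target : ∀ x → p (inj₁ x) ≡ just a → ∃[ l ] f (inj₁ x) ≡ inj₂ l
      C-target x px with f (inj₁ x) | f∈ (inj₁ x) px
      ... | inj₂ l | _ = l , refl

      D-target : ∀ i j → p (inj₂ (i , j)) ≡ just a →
        f (inj₂ (i , j)) ≡ inj₁ i ⊎ ∃[ l ] f (inj₂ (i , j)) ≡ inj₂ l
      D-target i j px with f (inj₂ (i , j)) | f∈ (inj₂ (i , j)) px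
      ... | inj₁ _ | refl = inj₁ refl
      ... | inj₂ l | _    = inj₂ (l , refl)

      C≤ : ∀ x → has p (just a) (inj₁ x) ≤ sum (use (inj₁ x))
      C≤ x = m≤1⇒m≤n (𝟙≤1 (p (inj₁ x) ≟ᵐ just a)) λ u →
        let px = 0<𝟙⇒ u; l , fx = C-target x px in uses l px fx

      D≤ : ∀ i → excess p a i ≤ sum λ j → sum (use (inj₂ (i , j)))
      D≤ i = m≤n+o⇒m∸n≤o (countD p (just a) i) 1 $ begin
        countD p (just a) i
          ≤⟨ sum-mono split ⟩
        sum (λ j → own j + shared j)
          ≡⟨ ∑-distrib-+ own shared ⟩
        sum own + sum shared
          ≤⟨ +-monoˡ-≤ (sum shared)
               (sum≤1 (λ j → 𝟙≤1 (via? (inj₂ (i , j)) (inj₁ i)))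
                      (λ j j′ u u′ → D-index-injective (via-unique u u′))) ⟩
        1 + sum shared ∎
        where
        own shared : Fin k → ℕ
        own j    = 𝟙 (via? (inj₂ (i , j)) (inj₁ i))
        shared j = sum (use (inj₂ (i , j)))

        split : ∀ j → has p (just a) (inj₂ (i , j)) ≤ own j + shared j
        split j = m≤1⇒m≤n (𝟙≤1 (p (inj₂ (i , j)) ≟ᵐ just a)) λ u → bound (0<𝟙⇒ u)
          where
          bound : p (inj₂ (i , j)) ≡ just a → 0 < own j + shared j
          bound px with D-target i j px
          ... | inj₁ fx       = ≤-trans (⇒0<𝟙 (via? (inj₂ (i , j)) (inj₁ i)) (px , fx)) (m≤m+n (own j) _)
          ... | inj₂ (l , fx) = ≤-trans (uses l px fx) (m≤n+m _ (own j))

      total≤1 : ∀ l → useC l + useD l ≤ 1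
      total≤1 l = +≤1
        (sum≤1 (λ x → 𝟙≤1 (via? (inj₁ x) (inj₂ l))) λ x x′ u u′ → Sumₚ.inj₁-injective (via-unique u u′))
        (sum≤1
          (λ i → sum≤1 (λ j → 𝟙≤1 (via? (inj₂ (i , j)) (inj₂ l)))
                       (λ j j′ u u′ → D-index-injective (via-unique u u′)))
          (λ i i′ u u′ → let _ , v = 0<sum⇒ (useDᵢ i) u; _ , v′ = 0<sum⇒ (useDᵢ i′) u′ in
            cong proj₁ (Sumₚ.inj₂-injective (via-unique v v′))))
        (λ u u′ → let _ , v = 0<sum⇒ (λ x → use (inj₁ x) l) u
                      i , w = 0<sum⇒ (λ i → sum (useDᵢ i)) u′
                      _ , v′ = 0<sum⇒ (useDᵢ i) w in
            inj₁≢inj₂ (via-unique v v′))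
        where
        useDᵢ : Fin (numD k) → Fin k → ℕ
        useDᵢ i j = use (inj₂ (i , j)) l

    -- Inside each D_i one element of the class is matched to D_i itself;
    -- all the others share the copies of E_k in the order of their offsets.
    module _ .{{_ : NonZero copies}} where

      matching : E k → Idx k
      matching (inj₁ x)       = inj₂ (offset (λ y → has p (just a) (inj₁ y)) x mod copies)
      matching (inj₂ (i , j)) with offset (λ j′ → has p (just a) (inj₂ (i , j′))) j
      ... | zero  = inj₁ i
      ... | suc t = inj₂ ((countC p (just a) + (offset (excess p a) i + t)) mod copies)

      load≤⇒independent : load p a ≤ copies → Independent k (λ x → p x ≡ just a)
      load≤⇒independent load≤ = matching , matching∈ , matching-injective
        where
        isC : Fin (sizeC k) → ℕ
        isC x = has p (just a) (inj₁ x)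

        isD : Fin (numD k) → Fin k → ℕ
        isD i j = has p (just a) (inj₂ (i , j))

        in-class : ∀ {x} → p x ≡ just a → 0 < has p (just a) x
        in-class {x} px = ⇒0<𝟙 (p x ≟ᵐ just a) px

        matching∈ : ∀ x → p x ≡ just a → _∈A_ {k} x (matching x)
        matching∈ (inj₁ x)       _ = _
        matching∈ (inj₂ (i , j)) _ with offset (isD i) j
        ... | zero  = refl
        ... | suc t = _

        C-rank< : ∀ {x} → p (inj₁ x) ≡ just a → offset isC x < countC p (just a)
        C-rank< {x} px = subst (_< _) (+-identityʳ (offset isC x)) (offset< isC (in-class px))

        -- The element of rank 0 is matched to `D_i`, so the ranks of the others shift down by one
        -- and stay below the excess.
        D-rank< : ∀ {i j t} → p (inj₂ (i , j)) ≡ just a → offset (isD i) j ≡ suc t → t < excess p a i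
        D-rank< {i} {j} {t} px eq = ∸-monoˡ-≤ 1 
          (subst (_< countD p (just a) i) (trans (+-identityʳ _) eq) (offset< (isD i) (in-class px)))

        C-rank<copies : ∀ {x} → p (inj₁ x) ≡ just a → offset isC x < copies
        C-rank<copies px = <-≤-trans (C-rank< px) (≤-trans (m≤m+n _ _) load≤)

        D-rank<copies : ∀ {i t} → t < excess p a i →
          countC p (just a) + (offset (excess p a) i + t) < copies
        D-rank<copies t< = <-≤-trans (+-monoʳ-< (countC p (just a)) (offset< (excess p a) t<)) load≤

        D-injective : ∀ {i j j′} → p (inj₂ (i , j)) ≡ just a → p (inj₂ (i , j′)) ≡ just a →
          offset (isD i) j ≡ offset (isD i) j′ → j ≡ j′
        D-injective {i} {j} {j′} px py eq =
          proj₁ (offset-injective (isD i) (in-class px) (in-class py) (cong (_+ 0) eq))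

        C≢D : ∀ {x i t} → p (inj₁ x) ≡ just a → t < excess p a i →
          offset isC x mod copies ≢ (countC p (just a) + (offset (excess p a) i + t)) mod copies
        C≢D px t< eq = <⇒≢ (<-≤-trans (C-rank< px) (m≤m+n _ _))
          (mod-injective (C-rank<copies px) (D-rank<copies t<) eq)

        matching-injective : ∀ x y → p x ≡ just a → p y ≡ just a → matching x ≡ matching y → x ≡ y
        matching-injective (inj₁ x) (inj₁ y) px py eq = cong inj₁ $ proj₁ $
          offset-injective isC (in-class px) (in-class py) $ cong (_+ 0) $
          mod-injective (C-rank<copies px) (C-rank<copies py) (Sumₚ.inj₂-injective eq)
        matching-injective (inj₁ x) (inj₂ (i , j)) px py eq with offset (isD i) j in o
        ... | suc t = ⊥-elim (C≢D px (D-rank< py o) (Sumₚ.inj₂-injective eq))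
        matching-injective (inj₂ (i , j)) (inj₁ y) px py eq with offset (isD i) j in o
        ... | suc t = ⊥-elim (C≢D py (D-rank< px o) (sym (Sumₚ.inj₂-injective eq)))
        matching-injective (inj₂ (i , j)) (inj₂ (i′ , j′)) px py eq
          with offset (isD i) j in o | offset (isD i′) j′ in o′
        ... | zero  | zero with refl ← eq = cong (λ l → inj₂ (i , l)) (D-injective px py (trans o (sym o′)))
        ... | suc t | suc t′
          with refl , refl ← offset-injective (excess p a) (D-rank< px o) (D-rank< py o′)
                 (+-cancelˡ-≡ (countC p (just a)) _ _
                   (mod-injective (D-rank<copies (D-rank< px o)) (D-rank<copies (D-rank< py o′))
                     (Sumₚ.inj₂-injective eq)))
          = cong (λ l → inj₂ (i , l)) (D-injective px py (trans o (sym o′)))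

  -- Quantities attached to a position

  uncoloured : Coloring k c → ℕ
  uncoloured p = countC p nothing

  free : Coloring k c → Fin (numD k) → ℕ
  free p = countD p nothing

  slack : Coloring k c → Fin c → ℕ
  slack p a = copies ∸ load p a

  totalSlack : Coloring k c → ℕ
  totalSlack p = sum (slack p)

  weightedSlack : Coloring k c → ℕ
  weightedSlack p = sum (weight ∘ slack p)

  -- Indicator that all `k` elements are uncoloured, in arithmetic form so that it can be computed
  -- from `free`.
  untouched : Coloring k c → Fin (numD k) → ℕ
  untouched p i = 1 ∸ (k ∸ free p i)

  fresh : Coloring k c → ℕ
  fresh p = sum (untouched p)

  Bounded : Coloring k c → Set
  Bounded p = ∀ a → load p a ≤ copies

  proper⇒bounded : ∀ {p} → Proper p → Bounded p
  proper⇒bounded proper a = independent⇒load≤ (proper a)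

  totalSlack≤weightedSlack : ∀ p → totalSlack p ≤ weightedSlack p
  totalSlack≤weightedSlack p = sum-mono λ a → s≤weight (slack p a)

  free+countD≤k : ∀ p a i → free p i + countD p (just a) i ≤ k
  free+countD≤k p a i = begin
    free p i + countD p (just a) i
      ≡⟨ ∑-distrib-+ (λ j → has p nothing (inj₂ (i , j))) (λ j → has p (just a) (inj₂ (i , j))) ⟨
    sum (λ j → has p nothing (inj₂ (i , j)) + has p (just a) (inj₂ (i , j)))
      ≤⟨ sum-mono (λ j → +≤1 (𝟙≤1 (p (inj₂ (i , j)) ≟ᵐ nothing)) (𝟙≤1 (p (inj₂ (i , j)) ≟ᵐ just a))
           λ u v → nothing≢just (trans (sym (0<𝟙⇒ u)) (0<𝟙⇒ v))) ⟩
    sum {k} (λ _ → 1)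
      ≡⟨ trans (sum-const k 1) (*-identityʳ k) ⟩
    k ∎
    where
    open ≤-Reasoning
    nothing≢just : nothing ≢ just a
    nothing≢just ()

  0<free⇒ : ∀ p i → 0 < free p i → ∃[ j ] p (inj₂ (i , j)) ≡ nothing
  0<free⇒ p i 0<free with j , u ← 0<sum⇒ (λ j → has p nothing (inj₂ (i , j))) 0<free = j , 0<𝟙⇒ u

  -- Effect of a single move on the counts

  countC-mono : ∀ {p q v} → (∀ x → p x ≡ v → q x ≡ v) → countC p v ≤ countC q v
  countC-mono {p} {q} {v} pq = sum-mono λ x → 𝟙-mono (p (inj₁ x) ≟ᵐ v) (q (inj₁ x) ≟ᵐ v) (pq _)

  countD-mono : ∀ {p q v} → (∀ x → p x ≡ v → q x ≡ v) → ∀ i → countD p v i ≤ countD q v i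
  countD-mono {p} {q} {v} pq i =
    sum-mono λ j → 𝟙-mono (p (inj₂ (i , j)) ≟ᵐ v) (q (inj₂ (i , j)) ≟ᵐ v) (pq _)

  countC-except : ∀ {p q v} x s t → (∀ y → y ≢ inj₁ x → p y ≡ q y) →
    has p v (inj₁ x) + s ≤ has q v (inj₁ x) + t → countC p v + s ≤ countC q v + t
  countC-except {v = v} x s t agree = sum-mono-except x s t λ y y≢x →
    ≤-reflexive (cong (λ w → 𝟙 (w ≟ᵐ v)) (agree _ (y≢x ∘ Sumₚ.inj₁-injective)))

  countD-except : ∀ {p q v} i j s t → (∀ y → y ≢ inj₂ (i , j) → p y ≡ q y) →
    has p v (inj₂ (i , j)) + s ≤ has q v (inj₂ (i , j)) + t → countD p v i + s ≤ countD q v i + t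
  countD-except {v = v} i j s t agree = sum-mono-except j s t λ y y≢x →
    ≤-reflexive (cong (λ w → 𝟙 (w ≟ᵐ v)) (agree _ (y≢x ∘ D-index-injective)))

  -- A move without `Proper`: for Bob's moves the loads are bounded first, and independence is
  -- derived from that.
  record Extends (p : Coloring k c) (e : E k) (a : Fin c) (q : Coloring k c) : Set where
    field
      blank  : p e ≡ nothing
      filled : q e ≡ just a
      frame  : ∀ x → x ≢ e → q x ≡ p x

    keeps : ∀ {b} x → p x ≡ just b → q x ≡ just b
    keeps x px with x ≟ᵉ e
    ... | no x≢e = trans (frame x x≢e) px
    ... | yes refl with () ← trans (sym blank) px

    was-blank : ∀ x → q x ≡ nothing → p x ≡ nothing
    was-blank x qx with x ≟ᵉ e
    ... | no x≢e = trans (sym (frame x x≢e)) qx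
    ... | yes refl = blank

    other-colour : ∀ {b} → b ≢ a → ∀ x → q x ≡ just b → p x ≡ just b
    other-colour b≢a x qx with x ≟ᵉ e
    ... | no x≢e = trans (sym (frame x x≢e)) qx
    ... | yes refl = contradiction (Maybeₚ.just-injective (trans (sym qx) filled)) b≢a

    blank-before : has p nothing e ≡ 1
    blank-before = ⇒𝟙≡1 (p e ≟ᵐ nothing) blank

    blank-after : has q nothing e ≡ 0
    blank-after = ¬⇒𝟙≡0 (q e ≟ᵐ nothing) λ qe → case trans (sym qe) filled of λ ()

    colour-before : has p (just a) e ≡ 0
    colour-before = ¬⇒𝟙≡0 (p e ≟ᵐ just a) λ pe → case trans (sym pe) blank of λ ()

    colour-after : has q (just a) e ≡ 1
    colour-after = ⇒𝟙≡1 (q e ≟ᵐ just a) filled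

    uncoloured≥ : uncoloured q ≤ uncoloured p
    uncoloured≥ = countC-mono was-blank

    countD≤ : ∀ b i → countD p (just b) i ≤ countD q (just b) i
    countD≤ b = countD-mono keeps

    load≤ : ∀ b → load p b ≤ load q b
    load≤ b = +-mono-≤ (countC-mono keeps) (sum-mono λ i → ∸-monoˡ-≤ 1 (countD≤ b i))

    load-other : ∀ {b} → b ≢ a → load q b ≤ load p b
    load-other b≢a = +-mono-≤ (countC-mono (other-colour b≢a))
      (sum-mono λ i → ∸-monoˡ-≤ 1 (countD-mono (other-colour b≢a) i))

    slack≥ : ∀ b → slack q b ≤ slack p b
    slack≥ b = ∸-monoʳ-≤ copies (load≤ b)

    totalSlack≥ : totalSlack q ≤ totalSlack p
    totalSlack≥ = sum-mono slack≥

    weightedSlack≥ : weightedSlack q ≤ weightedSlack p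
    weightedSlack≥ = sum-mono λ b → weight-mono (slack≥ b)

    weightedSlack-drop : ∀ {b} → slack q b < slack p b → weightedSlack q + 1 ≤ weightedSlack p
    weightedSlack-drop {b} lt = subst (_ ≤_) (+-identityʳ _) $
      sum-mono-except b 1 0 (λ b′ _ → weight-mono (slack≥ b′))
        (subst₂ _≤_ (+-comm 1 _) (sym (+-identityʳ _)) (weight-strict lt))

    -- Positive slack weighs at least 2 and slack 0 weighs nothing, so the last unit of a colour
    -- counts twice.
    weightedSlack-fill : ∀ {b} → slack q b ≡ 0 → 0 < slack p b → weightedSlack q + 2 ≤ weightedSlack p
    weightedSlack-fill {b} eq lt = subst (_ ≤_) (+-identityʳ _) $
      sum-mono-except b 2 0 (λ b′ _ → weight-mono (slack≥ b′))
        (subst₂ _≤_ (cong (λ s → weight s + 2) (sym eq)) (sym (+-identityʳ _)) (2≤weight lt))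

    -- The bound matters: `slack` is truncated and could otherwise stay at 0.
    slack-drop : Bounded q → load p a < load q a → slack q a < slack p a
    slack-drop bounded lt = ∸-monoʳ-< lt (bounded a)

    totalSlack-drop : slack q a < slack p a → totalSlack q < totalSlack p
    totalSlack-drop lt = subst₂ _≤_ (+-comm _ 1) (+-identityʳ _) $
      sum-mono-except a 1 0 (λ b _ → slack≥ b) (subst₂ _≤_ (+-comm 1 _) (sym (+-identityʳ _)) lt)

  module ExtendC {p x a q} (ext : Extends p (inj₁ x) a q) where
    open Extends ext public

    uncoloured> : uncoloured q + 1 ≤ uncoloured p
    uncoloured> = subst (_ ≤_) (+-identityʳ _) $ countC-except x 1 0 frame $
      ≤-reflexive (trans (cong (_+ 1) blank-after) (sym (cong (_+ 0) blank-before)))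

    uncoloured≤ : uncoloured p ≤ uncoloured q + 1
    uncoloured≤ = subst (_≤ _) (+-identityʳ _) $ countC-except x 0 1 (λ y y≢x → sym (frame y y≢x)) $
      ≤-reflexive (trans (cong (_+ 0) blank-before) (sym (cong (_+ 1) blank-after)))

    load< : load p a < load q a
    load< = +-mono-<-≤
      (subst₂ _≤_ (+-comm _ 1) (+-identityʳ _) $ countC-except x 1 0 (λ y y≢x → sym (frame y y≢x)) $
        ≤-reflexive (trans (cong (_+ 1) colour-before) (sym (cong (_+ 0) colour-after))))
      (sum-mono λ i → ∸-monoˡ-≤ 1 (countD≤ a i))

    free≡ : ∀ i → free q i ≡ free p i
    free≡ i = sum-cong-≗ λ j → cong (λ w → 𝟙 (w ≟ᵐ nothing)) (frame (inj₂ (i , j)) λ ())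

    fresh≤ : fresh p ≤ fresh q
    fresh≤ = sum-mono λ i → ≤-reflexive (cong (λ f → 1 ∸ (k ∸ f)) (sym (free≡ i)))

  module ExtendD {p i j a q} (ext : Extends p (inj₂ (i , j)) a q) where
    open Extends ext public

    uncoloured≤ : uncoloured p ≤ uncoloured q
    uncoloured≤ = sum-mono λ x → ≤-reflexive (cong (λ w → 𝟙 (w ≟ᵐ nothing)) (sym (frame (inj₁ x) λ ())))

    elsewhere : ∀ {i′} → i′ ≢ i → ∀ v → countD q v i′ ≡ countD p v i′
    elsewhere {i′} i′≢i v = sum-cong-≗ λ j′ →
      cong (λ w → 𝟙 (w ≟ᵐ v)) (frame (inj₂ (i′ , j′)) (i′≢i ∘ cong proj₁ ∘ Sumₚ.inj₂-injective))

    free≤ : ∀ i′ → free p i′ ≤ free q i′ + 1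
    free≤ i′ with i′ Finₚ.≟ i
    ... | no i′≢i = ≤-trans (≤-reflexive (sym (elsewhere i′≢i nothing))) (m≤m+n _ 1)
    ... | yes refl = subst (_≤ _) (+-identityʳ _) $ countD-except i j 0 1 (λ y y≢x → sym (frame y y≢x)) $
      ≤-reflexive (trans (cong (_+ 0) blank-before) (sym (cong (_+ 1) blank-after)))

    countD-grows : countD p (just a) i < countD q (just a) i
    countD-grows = subst₂ _≤_ (+-comm _ 1) (+-identityʳ _) $
      countD-except i j 1 0 (λ y y≢x → sym (frame y y≢x)) $
      ≤-reflexive (trans (cong (_+ 1) colour-before) (sym (cong (_+ 0) colour-after)))

    countD-grows≤ : countD q (just a) i ≤ countD p (just a) i + 1
    countD-grows≤ = subst (_≤ _) (+-identityʳ _) $ countD-except i j 0 1 frame $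
      ≤-reflexive (trans (cong (_+ 0) colour-after) (sym (cong (_+ 1) colour-before)))

    load-bound : ∀ s t → excess q a i + s ≤ excess p a i + t → load q a + s ≤ load p a + t
    load-bound s t h = subst₂ _≤_
      (sym (+-assoc (countC q (just a)) _ s)) (sym (+-assoc (countC p (just a)) _ t)) $
      +-mono-≤
        (sum-mono λ x → ≤-reflexive (cong (λ w → 𝟙 (w ≟ᵐ just a)) (frame (inj₁ x) λ ())))
        (sum-mono-except i s t
          (λ i′ i′≢i → ≤-reflexive (cong (_∸ 1) (elsewhere i′≢i (just a)))) h)

    -- `D_i` itself absorbs the first element of a colour; hence the opening move of a run wastes
    -- nothing.
    load-fresh : countD p (just a) i ≡ 0 → load q a ≤ load p a
    load-fresh eq = +-cancelʳ-≤ 0 _ _ $ load-bound 0 0 $ +-monoˡ-≤ 0 $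
      ≤-trans (∸-monoˡ-≤ 1 countD-grows≤) (≤-reflexive (trans (cong (λ n → n + 1 ∸ 1) eq) (sym (cong (_∸ 1) eq))))

    load≤+1 : load q a ≤ load p a + 1
    load≤+1 = subst (_≤ load p a + 1) (+-identityʳ (load q a)) $ load-bound 0 1 $
      subst (_≤ excess p a i + 1) (sym (+-identityʳ (excess q a i))) $
      ≤-trans (∸-monoˡ-≤ 1 countD-grows≤) (m+1∸1≤ {countD p (just a) i})
      where
      m+1∸1≤ : ∀ {m} → m + 1 ∸ 1 ≤ m ∸ 1 + 1
      m+1∸1≤ {zero}  = z≤n
      m+1∸1≤ {suc m} = ≤-refl

    -- The source of Bob's waste: beyond the first, each element of the same colour in `D_i` takes
    -- up a copy of `E k`.
    load-used : 0 < countD p (just a) i → load p a < load q a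
    load-used 0<cnt = +-mono-≤-< (countC-mono keeps) $
      subst₂ _≤_ (+-comm _ 1) (+-identityʳ _) $
      sum-mono-except {f = excess p a} i 1 0 (λ i′ _ → ∸-monoˡ-≤ 1 (countD≤ a i′)) $
      subst₂ _≤_ (+-comm 1 _) (sym (+-identityʳ _)) (∸-monoˡ-< countD-grows 0<cnt)

    fresh≤+1 : fresh p ≤ fresh q + 1
    fresh≤+1 = subst (_≤ _) (+-identityʳ _) $ sum-mono-except i 0 1
      (λ i′ i′≢i → ≤-reflexive (cong (λ f → 1 ∸ (k ∸ f)) (sym (elsewhere i′≢i nothing))))
      (subst₂ _≤_ (sym (+-identityʳ _)) (+-comm 1 _) (≤-trans (m∸n≤m 1 (k ∸ free p i)) (s≤s z≤n)))

    fresh≤-used : free p i < k → fresh p ≤ fresh q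
    fresh≤-used lt = subst₂ _≤_ (+-identityʳ _) (+-identityʳ _) $ sum-mono-except i 0 0
      (λ i′ i′≢i → ≤-reflexive (cong (λ f → 1 ∸ (k ∸ f)) (sym (elsewhere i′≢i nothing))))
      (+-monoˡ-≤ 0 (≤-trans (≤-reflexive (m≤n⇒m∸n≡0 (m<n⇒0<n∸m lt))) z≤n))

  bounded-after : ∀ {p e a q} → Extends p e a q → Bounded p → load q a ≤ copies → Bounded q
  bounded-after {a = a} ext bounded h b with b Finₚ.≟ a
  ... | yes refl = h
  ... | no b≢a   = ≤-trans (Extends.load-other ext b≢a) (bounded b)

  move⇒extends : ∀ {p e a q} → Move p e a q → Extends p e a q
  move⇒extends (blank , filled , frame , _) = record { blank = blank ; filled = filled ; frame = frame }

  move⇒bounded : ∀ {p e a q} → Move p e a q → Bounded q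
  move⇒bounded (_ , _ , _ , proper) = proper⇒bounded proper

  colour : Coloring k c → E k → Fin c → Coloring k c
  colour p e a x = if does (x ≟ᵉ e) then just a else p x

  colour-extends : ∀ {p e} a → p e ≡ nothing → Extends p e a (colour p e a)
  colour-extends {p} {e} a pe = record
    { blank  = pe
    ; filled = cong (if_then just a else p e) (dec-true (e ≟ᵉ e) refl)
    ; frame  = λ x x≢e → cong (if_then just a else p x) (dec-false (x ≟ᵉ e) x≢e)
    }

  uncoloured>0⇒¬full : ∀ {p} → 0 < uncoloured p → ¬ Full {k} p
  uncoloured>0⇒¬full {p} 0<r full
    with x , u ← 0<sum⇒ (λ x → has p nothing (inj₁ x)) 0<r
    with a , px ← full (inj₁ x) with () ← trans (sym (0<𝟙⇒ u)) px

  -- Positions lost for Alice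

  Doomed : Coloring k c → Set
  Doomed p = totalSlack p < uncoloured p

  doomed-move : ∀ {p e a q} → Move p e a q → Doomed p → Doomed q
  doomed-move {e = inj₁ x} mv doomed =
    s≤s⁻¹ (≤-trans (s≤s (totalSlack-drop (slack-drop (move⇒bounded mv) load<)))
      (≤-trans doomed (≤-trans uncoloured≤ (≤-reflexive (+-comm _ 1)))))
    where open ExtendC (move⇒extends mv)
  doomed-move {e = inj₂ _} mv doomed = ≤-<-trans totalSlack≥ (<-≤-trans doomed uncoloured≤)
    where open ExtendD (move⇒extends mv)

  doomed-A : ∀ {p} → Doomed p → ¬ AliceWinsA {k} {c} p
  doomed-B : ∀ {p} → Doomed p → ¬ AliceWinsB {k} {c} p
  doomed-A doomed (doneA full)          = uncoloured>0⇒¬full (≤-<-trans z≤n doomed) full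
  doomed-A doomed (moveA e a q mv wins) = doomed-B (doomed-move mv doomed) wins
  doomed-B doomed (doneB full)          = uncoloured>0⇒¬full (≤-<-trans z≤n doomed) full
  doomed-B doomed (allB (e , a , q , mv) wins) = doomed-A (doomed-move mv doomed) (wins e a q mv)

  -- Bob's strategy and its invariants

  record Active (p : Coloring k c) (i : Fin (numD k)) (a : Fin c) (f : ℕ) : Set where
    field
      used : 0 < countD p (just a) i
      open-colour : 0 < slack p a
      -- Only a lower bound: after an Alice move outside `C` one element is written off, whichever
      -- set she touched.
      room : f ≤ free p i

    free<k : free p i < k
    free<k = ≤-trans (≤-reflexive (+-comm 1 _)) (≤-trans (+-monoʳ-≤ (free p i) used) (free+countD≤k p a i))

    run<k : f < k
    run<k = ≤-<-trans room free<k

  -- Bob plays in runs: he picks an untouched D_i and a colour with slack and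
  -- colours D_i with it.  At least "run" moves of the current run are still
  -- available, and "runs" is the number of further runs that Bob may have to start.
  record AliceTurn (p : Coloring k c) : Set where
    field
      run runs : ℕ
      budget : weightedSlack p + 1 + runs ≤ 2 * uncoloured p
      cover  : uncoloured p ≤ 1 + run + k * runs
      supply : 3 * weightedSlack p + reserve run ≤ fresh p + 3 * uncoloured p
      active : run ≡ 0 ⊎ ∃[ i ] ∃[ a ] Active p i a run

    uncoloured>0 : 0 < uncoloured p
    uncoloured>0 = 0<2*⇒ (≤-trans (≤-trans (m≤n+m 1 (weightedSlack p)) (m≤m+n _ runs)) budget)

  -- The unit set aside for Alice's move is gone. In `continue` the supply may be one set in debt,
  -- which the next wasting move repays; in `start` it keeps one unit for the set that Bob is about
  -- to touch.
  data BobTurn (p : Coloring k c) : Set where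
    continue : ∀ {runs f i a} → Active p i a (1 + f) →
      weightedSlack p + runs ≤ 2 * uncoloured p →
      uncoloured p ≤ 1 + f + k * runs →
      3 * weightedSlack p ≤ fresh p + 1 + 3 * uncoloured p → BobTurn p
    start : ∀ {runs} → 0 < uncoloured p →
      weightedSlack p + runs ≤ 2 * uncoloured p →
      uncoloured p ≤ k * runs →
      3 * weightedSlack p + 1 ≤ fresh p + 3 * uncoloured p → BobTurn p

  2≤weightedSlack : ∀ p a → 0 < slack p a → 2 ≤ weightedSlack p
  2≤weightedSlack p a 0<s = ≤-trans (2≤weight 0<s) (term≤sum (weight ∘ slack p) a)

  bob-uncoloured>0 : ∀ {p} → BobTurn p → 0 < uncoloured p
  bob-uncoloured>0 {p} (continue {a = a} act budget _ _) =
    0<2*⇒ (≤-trans (≤-trans (<⇒≤ (2≤weightedSlack p a (Active.open-colour act))) (m≤m+n _ _)) budget)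
  bob-uncoloured>0 (start 0<r _ _ _) = 0<r

  module _ (2<k : 2 < k) where

    private instance
      copies-nonZero : NonZero copies
      copies-nonZero = >-nonZero (m<n⇒0<n∸m (≤-trans (<⇒≤ 2<k) (m≤m+n k _)))

    extends⇒move : ∀ {p e a q} → Extends p e a q → Bounded q → Move p e a q
    extends⇒move ext bounded = blank , filled , frame , λ b → load≤⇒independent (bounded b)
      where open Extends ext

    -- Alice's moves

    alice-C : ∀ {p x a q} → Move p (inj₁ x) a q → AliceTurn p → BobTurn q
    alice-C {p} {x} {a} {q} mv turn = go run active cover supply
      where
      open ExtendC (move⇒extends mv)
      open AliceTurn turn using (run; runs; active; budget; cover; supply)

      drop : slack q a < slack p a
      drop = slack-drop (move⇒bounded mv) load<

      -- The colour just used had slack and weighed at least 2. With the extra unit of the budget,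
      -- `2 * uncoloured p` is at least 3, so `C` had a second uncoloured element.
      q>0 : 0 < uncoloured q
      q>0 = 3≤2*⇒ (begin
        3                                 ≤⟨ +-monoˡ-≤ 1 (2≤weightedSlack p a (≤-<-trans z≤n drop)) ⟩
        weightedSlack p + 1               ≤⟨ m≤m+n _ runs ⟩
        weightedSlack p + 1 + runs        ≤⟨ budget ⟩
        2 * uncoloured p                  ≤⟨ scale 2 uncoloured≤ ⟩
        2 * (uncoloured q + 1)            ∎)
        where open ≤-Reasoning

      smaller : ∀ {n} → uncoloured p ≤ suc n → uncoloured q ≤ n
      smaller h = s≤s⁻¹ (≤-trans (≤-reflexive (+-comm 1 _)) (≤-trans uncoloured> h))

      go : ∀ run → run ≡ 0 ⊎ ∃[ i ] ∃[ b ] Active p i b run →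
        uncoloured p ≤ 1 + run + k * runs →
        3 * weightedSlack p + reserve run ≤ fresh p + 3 * uncoloured p → BobTurn q
      go zero _ cover supply = start q>0
        (budget-C (weightedSlack-drop drop) uncoloured≤ budget)
        (smaller cover)
        (≤-trans (+-monoʳ-≤ _ (s≤s z≤n))
          (supply-C {x = 2} (weightedSlack-drop drop) uncoloured≤ fresh≤ supply))
      go (suc f) (inj₂ (i , b , act)) cover supply with slack q b in eq
      -- Alice has filled the colour of the run: the run is given up, and the extra unit of its
      -- weight buys a new one.
      ... | zero = start q>0
        (budget-C-full (weightedSlack-fill eq (Active.open-colour act)) uncoloured≤ budget)
        (cover-restart uncoloured≥ (Active.run<k act) cover)
        (supply-C-full {x = reserve (suc f)}
          (weightedSlack-fill eq (Active.open-colour act)) uncoloured≤ fresh≤ supply)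
      ... | suc s = continue
        (record { used = ≤-trans used (countD≤ b i)
                ; open-colour = subst (0 <_) (sym eq) (s≤s z≤n)
                ; room = ≤-trans room (≤-reflexive (sym (free≡ i))) })
        (budget-C (weightedSlack-drop drop) uncoloured≤ budget)
        (smaller cover)
        (≤-trans
          (m+n≤o⇒m≤o _ (supply-C {x = reserve (suc f)} (weightedSlack-drop drop) uncoloured≤ fresh≤ supply))
          (+-monoˡ-≤ (3 * uncoloured q) (m≤m+n (fresh q) 1)))
        where open Active act

    alice-D : ∀ {p i j a q} → Move p (inj₂ (i , j)) a q → AliceTurn p → BobTurn q
    alice-D {p} {i} {j} {a} {q} mv turn = go run active cover supply
      where
      open ExtendD (move⇒extends mv)
      open AliceTurn turn using (run; runs; active; budget; cover; supply; uncoloured>0)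

      q>0 : 0 < uncoloured q
      q>0 = ≤-trans uncoloured>0 uncoloured≤

      go : ∀ run → run ≡ 0 ⊎ ∃[ i ] ∃[ b ] Active p i b run →
        uncoloured p ≤ 1 + run + k * runs →
        3 * weightedSlack p + reserve run ≤ fresh p + 3 * uncoloured p → BobTurn q
      go zero _ cover supply = start q>0 (budget-D weightedSlack≥ uncoloured≤ budget)
        (cover-restart uncoloured≥ (≤-trans (s≤s z≤n) 2<k) cover)
        (supply-D weightedSlack≥ uncoloured≤ fresh≤+1 supply)
      -- The one element left may be the one that Alice has just coloured, so the run counts as
      -- finished.
      go (suc zero) _ cover supply = start q>0 (budget-D weightedSlack≥ uncoloured≤ budget)
        (cover-restart uncoloured≥ (<⇒≤ 2<k) cover)
        (supply-D weightedSlack≥ uncoloured≤ fresh≤+1 supply)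
      go (suc (suc f)) (inj₂ (i′ , b , act)) cover supply with slack q b in eq
      -- Her move outside `C` already buys the new run; the fall in weight serves the supply, as
      -- `reserve` is 0 here.
      ... | zero = start q>0 (budget-D weightedSlack≥ uncoloured≤ budget)
        (cover-restart uncoloured≥ (Active.run<k act) cover)
        (supply-D-full (weightedSlack-fill eq (Active.open-colour act)) uncoloured≤ fresh≤+1 supply)
      ... | suc s = continue
        (record { used = ≤-trans used (countD≤ b i′)
                ; open-colour = subst (0 <_) (sym eq) (s≤s z≤n)
                ; room = s≤s⁻¹ (≤-trans room (≤-trans (free≤ i′) (≤-reflexive (+-comm _ 1)))) })
        (budget-D weightedSlack≥ uncoloured≤ budget)
        (cover-D uncoloured≥ (<⇒≤ 2<k) cover)
        (supply-D-continue weightedSlack≥ uncoloured≤ fresh≤+1 supply)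
        where open Active act

    alice-move : ∀ {p e a q} → Move p e a q → AliceTurn p → BobTurn q
    alice-move {e = inj₁ _} = alice-C
    alice-move {e = inj₂ _} = alice-D

    -- Bob's replies

    Reply : Coloring k c → Set
    Reply p = ∃[ e ] ∃[ a ] ∃[ q ] (Move p e a q × AliceTurn q)

    bob-continue : ∀ {p runs f i a} → Bounded p → Active p i a (1 + f) →
      weightedSlack p + runs ≤ 2 * uncoloured p →
      uncoloured p ≤ 1 + f + k * runs →
      3 * weightedSlack p ≤ fresh p + 1 + 3 * uncoloured p → Reply p
    bob-continue {p} {runs} {f} {i} {a} bounded act budget cover supply =
      inj₂ (i , j) , a , q , extends⇒move ext bounded-q , turn
      where
      open Active act
      j = proj₁ (0<free⇒ p i (≤-trans (s≤s z≤n) room))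
      q = colour p (inj₂ (i , j)) a
      ext : Extends p (inj₂ (i , j)) a q
      ext = colour-extends a (proj₂ (0<free⇒ p i (≤-trans (s≤s z≤n) room)))
      open ExtendD ext

      bounded-q : Bounded q
      bounded-q = bounded-after ext bounded (≤-trans load≤+1 (begin
        load p a + 1          ≤⟨ +-monoʳ-≤ (load p a) open-colour ⟩
        load p a + slack p a  ≡⟨ m+[n∸m]≡n (bounded a) ⟩
        copies                ∎))
        where open ≤-Reasoning

      turn : AliceTurn q
      turn with slack q a in eq
      -- Bob himself has used the last unit of the colour; its double count buys a run in place of
      -- the rest of this one.
      ... | zero = record
        { run    = 0
        ; runs   = 1 + runs
        ; budget = budget-full (weightedSlack-fill eq open-colour) uncoloured≤ budget
        ; cover  = cover-full uncoloured≥ (<⇒≤ (<⇒≤ run<k)) cover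
        ; supply = supply-continue ≤-refl (weightedSlack-drop (slack-drop bounded-q (load-used used)))
                     uncoloured≤ (fresh≤-used free<k) supply
        ; active = inj₁ refl
        }
      ... | suc s = record
        { run    = f
        ; runs   = runs
        ; budget = budget-continue (weightedSlack-drop (slack-drop bounded-q (load-used used))) uncoloured≤ budget
        ; cover  = ≤-trans uncoloured≥ cover
        ; supply = supply-continue (reserve≤2 f) (weightedSlack-drop (slack-drop bounded-q (load-used used)))
                     uncoloured≤ (fresh≤-used free<k) supply
        ; active = inj₂ (i , a , record
            { used = ≤-trans used (countD≤ a i)
            ; open-colour = subst (0 <_) (sym eq) (s≤s z≤n)
            ; room = s≤s⁻¹ (≤-trans room (≤-trans (free≤ i) (≤-reflexive (+-comm _ 1)))) })
        }

    bob-start : ∀ {p runs i a} → Bounded p → 0 < slack p a → 0 < untouched p i →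
      weightedSlack p + (1 + runs) ≤ 2 * uncoloured p →
      uncoloured p ≤ k * (1 + runs) →
      3 * weightedSlack p + 1 ≤ fresh p + 3 * uncoloured p → Reply p
    bob-start {p} {runs} {i} {a} bounded 0<slack unt budget cover supply =
      inj₂ (i , j) , a , q , extends⇒move ext bounded-q , turn
      where
      k≤free : k ≤ free p i
      k≤free = m∸n≡0⇒m≤n (0<1∸n⇒n≡0 unt)

      unused : countD p (just a) i ≡ 0
      unused = n≤0⇒n≡0 (+-cancelˡ-≤ (free p i) _ 0
        (≤-trans (free+countD≤k p a i) (≤-trans k≤free (≤-reflexive (sym (+-identityʳ _))))))

      blank-j = 0<free⇒ p i (≤-trans (≤-trans (s≤s z≤n) 2<k) k≤free)
      j = proj₁ blank-j
      q = colour p (inj₂ (i , j)) a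
      ext : Extends p (inj₂ (i , j)) a q
      ext = colour-extends a (proj₂ blank-j)
      open ExtendD ext

      bounded-q : Bounded q
      bounded-q = bounded-after ext bounded (≤-trans (load-fresh unused) (bounded a))

      1+[k∸1]≡k : 1 + (k ∸ 1) ≡ k
      1+[k∸1]≡k = m+[n∸m]≡n (≤-trans (s≤s z≤n) 2<k)

      turn : AliceTurn q
      turn = record
        -- As `2 < k`, at least two moves remain after the opening one; no reserve is due, and the
        -- unit kept in the supply pays for the set just touched.
        { run    = k ∸ 1
        ; runs   = runs
        ; budget = budget-start weightedSlack≥ uncoloured≤ budget
        ; cover  = ≤-trans uncoloured≥ (≤-trans cover (≤-reflexive
                     (trans (*-suc k runs) (cong (_+ k * runs) (sym 1+[k∸1]≡k)))))
        ; supply = subst (λ x → 3 * weightedSlack q + x ≤ fresh q + 3 * uncoloured q)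
                     (sym (reserve≡0 (∸-monoˡ-≤ 1 2<k)))
                     (supply-start weightedSlack≥ uncoloured≤ fresh≤+1 supply)
        ; active = inj₂ (i , a , record
            { used = ≤-<-trans z≤n countD-grows
            ; open-colour = <-≤-trans 0<slack (∸-monoʳ-≤ copies (load-fresh unused))
            ; room = ≤-trans (∸-monoˡ-≤ 1 (≤-trans k≤free (free≤ i))) (≤-reflexive (m+n∸n≡m (free q i) 1)) })
        }

    -- A new run fails only for want of slack or of an untouched set, and either shortage means that
    -- Alice has lost.
    bob-move : ∀ {p} → Bounded p → BobTurn p → Doomed p ⊎ Reply p
    bob-move bounded (continue act budget cover supply) = inj₂ (bob-continue bounded act budget cover supply)
    bob-move bounded (start {zero} 0<r budget cover supply) =
      contradiction (<-≤-trans 0<r (≤-trans cover (≤-reflexive (*-zeroʳ k)))) λ ()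
    bob-move {p} bounded (start {suc runs} 0<r budget cover supply) with totalSlack p in eqS | fresh p in eqF
    ... | zero  | _     = inj₁ 0<r
    -- Without untouched sets the supply forces `weightedSlack p < uncoloured p`, and the weights
    -- dominate the slack.
    ... | suc _ | zero  = inj₁ (subst (_< uncoloured p) eqS
      (≤-<-trans (totalSlack≤weightedSlack p)
        (*-cancelˡ-< 3 (weightedSlack p) (uncoloured p) (≤-trans (≤-reflexive (+-comm 1 _)) supply))))
    ... | suc _ | suc _
      with a , 0<slack ← 0<sum⇒ (slack p) (subst (0 <_) (sym eqS) (s≤s z≤n))
         | i , unt ← 0<sum⇒ (untouched p) (subst (0 <_) (sym eqF) (s≤s z≤n))
      = inj₂ (bob-start bounded 0<slack unt budget cover
          (subst (λ d → 3 * weightedSlack p + 1 ≤ d + 3 * uncoloured p) (sym eqF) supply))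

    -- Induction on Alice's strategy: the invariants keep an element of `C` uncoloured, so neither
    -- `doneA` nor `doneB` can occur.
    bob-wins-A : ∀ {p} → AliceTurn p → ¬ AliceWinsA {k} {c} p
    bob-wins-B : ∀ {p} → Bounded p → BobTurn p → ¬ AliceWinsB {k} {c} p
    bob-wins-A turn (doneA full) = uncoloured>0⇒¬full (AliceTurn.uncoloured>0 turn) full
    bob-wins-A turn (moveA e a q mv wins) = bob-wins-B (move⇒bounded mv) (alice-move mv turn) wins
    bob-wins-B bounded turn (doneB full) = uncoloured>0⇒¬full (bob-uncoloured>0 turn) full
    bob-wins-B bounded turn wins@(allB _ next) with bob-move bounded turn
    ... | inj₁ doomed = doomed-B doomed wins
    ... | inj₂ (e , a , q , mv , turn′) = bob-wins-A turn′ (next e a q mv)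

    -- The opening position

    initial : c < copies → AliceTurn empty
    initial c<copies = record
      { run    = 0
      -- `C` has `k * copies` elements, and a run of `k` moves keeps pace with `k` moves of Alice in
      -- `C`.
      ; runs   = copies
      ; budget = subst (λ r → weightedSlack empty + 1 + copies ≤ 2 * r) (sym r≡)
                   (budget-initial {k = k} c<copies 1+copies σ≤)
      ; cover  = ≤-trans (≤-reflexive r≡) (n≤1+n _)
      ; supply = subst₂ (λ d r → 3 * weightedSlack empty + 2 ≤ d + 3 * r) (sym d≡) (sym r≡)
                   (supply-initial {k = k} c<copies 1+copies σ≤)
      ; active = inj₁ refl
      }
      where
      1+copies : 1 + copies ≡ 2 * k
      1+copies = m+[n∸m]≡n (≤-trans (≤-trans (s≤s z≤n) 2<k) (m≤m+n k _))

      σ≤ : weightedSlack empty ≤ c * (1 + copies)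
      σ≤ = ≤-trans (sum-mono λ a → ≤-trans (weight≤suc _) (s≤s (m∸n≤m copies (load empty a))))
             (≤-reflexive (sum-const c (1 + copies)))

      r≡ : uncoloured empty ≡ k * copies
      r≡ = trans (sum-const (sizeC k) 1) (*-identityʳ (sizeC k))

      free≡k : ∀ i → free empty i ≡ k
      free≡k i = trans (sum-const k 1) (*-identityʳ k)

      d≡ : fresh empty ≡ 3 * (k * copies)
      d≡ = trans (sum-cong-≗ λ i → trans (cong (λ f → 1 ∸ (k ∸ f)) (free≡k i)) (cong (1 ∸_) (n∸n≡0 k)))
             (trans (sum-const (numD k) 1) (*-identityʳ (numD k)))

theorem13 : (k c : ℕ) → 2 < k → AliceWins k c → 2 * k ∸ 1 ≤ c
theorem13 k c 2<k wins = ≮⇒≥ λ c<copies → bob-wins-A 2<k (initial 2<k c<copies) wins
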